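{- The logic $\mathsf{bMDL}$ has the finite model property (every formula that is not a theorem of $\mathsf{bMDL}$ fails to be valid in some m-model with a finite set of worlds) and is decidable (the set of theorems of $\mathsf{bMDL}$ is decidable).
   Context: Formulae are built from a (countable) set $\mathsf{Var}$ of propositional variables and $\bot$ using the classical connectives $\neg,\land,\lor,\to$, a unary modality $\Box$ and a binary modality $\mathcal{O}(\cdot/\cdot)$. The logic $\mathsf{bMDL}$ is given by the Hilbert system for modal logic $\mathsf{S4}$ (classical propositional tautologies over the full language, $\Box(\varphi\to\psi)\to(\Box\varphi\to\Box\psi)$, $\Box\varphi\to\varphi$, $\Box\varphi\to\Box\Box\varphi$, modus ponens, necessitation: from $\varphi$ infer $\Box\varphi$) together with the axiom schemata (1) $(\Box(\varphi\to\psi)\land\mathcal{O}(\varphi/\theta))\to\mathcal{O}(\psi/\theta)$; (2) $\Box(\psi\to\neg\varphi)\to\neg(\mathcal{O}(\varphi/\theta)\land\mathcal{O}(\psi/\theta))$; (3) $(\Box((\psi\to\theta)\land(\theta\to\psi))\land\mathcal{O}(\varphi/\psi))\to\mathcal{O}(\varphi/\theta)$. Semantics. For $R\subseteq W\times W$ and $w\in W$ let $R[w]=\{v\in W\mid wRv\}$; $X^c$ is the complement of $X$ in $W$; $\mathcal{P}$ denotes power set. An m-frame is a triple $(W,R,\eta)$ with $W$ a non-empty set, $R\subseteq W\times W$ and $\eta:W\to\mathcal{P}(\mathcal{P}(W)\times\mathcal{P}(W))$ such that for all $w\in W$ and $X,Y,Z\subseteq W$: (i) $R$ is transitive and reflexive;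 (ii) if $(X,Y)\in\eta(w)$ then $X\subseteq R[w]$ and $Y\subseteq R[w]$; (iii) if $(X,Z)\in\eta(w)$ and $X\subseteq Y\subseteq R[w]$ then $(Y,Z)\in\eta(w)$; (iv) $(\emptyset,X)\notin\eta(w)$; (v) if $(X,Y)\in\eta(w)$ then $(X^c\cap R[w],Y)\notin\eta(w)$. An m-model is an m-frame with a valuation $\sigma:W\to\mathcal{P}(\mathsf{Var})$. Truth sets are defined by $[\![p]\!]=\{w\in W\mid p\in\sigma(w)\}$, the usual clauses for Boolean connectives, $[\![\Box\varphi]\!]=\{w\in W\mid R[w]\subseteq[\![\varphi]\!]\}$, and $[\![\mathcal{O}(\varphi/\psi)]\!]=\{w\in W\mid([\![\varphi]\!]\cap R[w],[\![\psi]\!]\cap R[w])\in\eta(w)\}$. A formula is valid in an m-model if its truth set is $W$. -}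

module Defs where

open import Data.Bool using (Bool; true; false; not; _∧_; _∨_)
open import Data.Fin using (Fin)
open import Data.Nat using (ℕ)
open import Data.Product using (∃-syntax)
open import Function.Bundles using (_↔_)
open import Level using (0ℓ)
open import Relation.Binary.Core using (Rel)
open import Relation.Binary.Definitions using (Reflexive; Transitive)
open import Relation.Binary.PropositionalEquality using (_≡_)
open import Relation.Nullary using (¬_)
open import Relation.Unary using (Pred; _∈_; _⊆_; _≐_; ∅; ∁; _∩_; _∪_; _⇒_)

Var : Set
Var = ℕ

infixr 9 ¬ᶠ_ □_
infixr 8 _∧ᶠ_
infixr 7 _∨ᶠ_
infixr 6 _→ᶠ_

data Formula : Set where
  var              : Var → Formula
  ⊥ᶠ               : Formula
  ¬ᶠ_              : Formula → Formula
  _∧ᶠ_ _∨ᶠ_ _→ᶠ_   : Formula → Formula → Formula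
  □_               : Formula → Formula
  𝒪⟨_/_⟩           : Formula → Formula → Formula

-- Variables and formulae headed by a modality are the atoms of
-- propositional reasoning over the full language; v is only consulted there.
eval : (Formula → Bool) → Formula → Bool
eval v (var p)      = v (var p)
eval v ⊥ᶠ           = false
eval v (¬ᶠ φ)       = not (eval v φ)
eval v (φ ∧ᶠ ψ)     = eval v φ ∧ eval v ψ
eval v (φ ∨ᶠ ψ)     = eval v φ ∨ eval v ψ
eval v (φ →ᶠ ψ)     = not (eval v φ) ∨ eval v ψ
eval v (□ φ)        = v (□ φ)
eval v 𝒪⟨ φ / ψ ⟩   = v 𝒪⟨ φ / ψ ⟩

Tautology : Formula → Set
Tautology φ = ∀ v → eval v φ ≡ true

infix 3 ⊢_

data ⊢_ : Formula → Set where
  taut : ∀ {φ} → Tautology φ → ⊢ φ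
  K    : ∀ {φ ψ} → ⊢ □ (φ →ᶠ ψ) →ᶠ (□ φ →ᶠ □ ψ)
  T    : ∀ {φ} → ⊢ □ φ →ᶠ φ
  four : ∀ {φ} → ⊢ □ φ →ᶠ □ □ φ
  ax₁  : ∀ {φ ψ θ} →
         ⊢ (□ (φ →ᶠ ψ) ∧ᶠ 𝒪⟨ φ / θ ⟩) →ᶠ 𝒪⟨ ψ / θ ⟩
  ax₂  : ∀ {φ ψ θ} →
         ⊢ □ (ψ →ᶠ ¬ᶠ φ) →ᶠ ¬ᶠ (𝒪⟨ φ / θ ⟩ ∧ᶠ 𝒪⟨ ψ / θ ⟩)
  ax₃  : ∀ {φ ψ θ} →
         ⊢ (□ ((ψ →ᶠ θ) ∧ᶠ (θ →ᶠ ψ)) ∧ᶠ 𝒪⟨ φ / ψ ⟩) →ᶠ 𝒪⟨ φ / θ ⟩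
  mp   : ∀ {φ ψ} → ⊢ φ →ᶠ ψ → ⊢ φ → ⊢ ψ
  nec  : ∀ {φ} → ⊢ φ → ⊢ □ φ

-- Subsets of W are predicates on W, identified up to _≐_, and R w is R[w].
record MFrame : Set₁ where
  field
    W         : Set
    inhabited : W
    R         : Rel W 0ℓ
    η         : W → Pred W 0ℓ → Pred W 0ℓ → Set
    -- η w is a relation between subsets, so it must not distinguish
    -- predicates with the same elements.
    η-resp-≐  : ∀ {w X X′ Y Y′} → X ≐ X′ → Y ≐ Y′ → η w X Y → η w X′ Y′
    R-refl    : Reflexive R
    R-trans   : Transitive R
    η-⊆ˡ      : ∀ {w X Y} → η w X Y → X ⊆ R w
    η-⊆ʳ      : ∀ {w X Y} → η w X Y → Y ⊆ R w
    η-upward  : ∀ {w X Y Z} → η w X Z → X ⊆ Y → Y ⊆ R w → η w Y Z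
    η-∅       : ∀ {w X} → ¬ η w ∅ X
    η-∁       : ∀ {w X Y} → η w X Y → ¬ η w (∁ X ∩ R w) Y

record MModel : Set₁ where
  field
    frame : MFrame
  open MFrame frame public
  field
    σ     : W → Pred Var 0ℓ

  ⟦_⟧ : Formula → Pred W 0ℓ
  ⟦ var p ⟧      = λ w → p ∈ σ w
  ⟦ ⊥ᶠ ⟧         = ∅
  ⟦ ¬ᶠ φ ⟧       = ∁ ⟦ φ ⟧
  ⟦ φ ∧ᶠ ψ ⟧     = ⟦ φ ⟧ ∩ ⟦ ψ ⟧
  ⟦ φ ∨ᶠ ψ ⟧     = ⟦ φ ⟧ ∪ ⟦ ψ ⟧
  ⟦ φ →ᶠ ψ ⟧     = ⟦ φ ⟧ ⇒ ⟦ ψ ⟧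
  ⟦ □ φ ⟧        = λ w → R w ⊆ ⟦ φ ⟧
  ⟦ 𝒪⟨ φ / ψ ⟩ ⟧ = λ w → η w (⟦ φ ⟧ ∩ R w) (⟦ ψ ⟧ ∩ R w)

infix 3 _⊨_

_⊨_ : MModel → Formula → Set
M ⊨ φ = ∀ w → w ∈ MModel.⟦_⟧ M φ

Finite : Set → Set
Finite A = ∃[ n ] A ↔ Fin n

{-# OPTIONS --safe #-}
-- Type elimination relative to the atoms of φ₀ (its variables and its
-- subformulae headed by a modality). Start from all valuations of the atoms and
-- call v accessible from w when v keeps every boxed atom true at w. Each
-- instance of T, of the rule for □ or of the deontic axioms has the shape
-- □ θ → ρ, so a valuation w refuting ρ needs an accessible v refuting θ.
-- A valuation lacking such a v is refutable in bMDL, because the boxed atoms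
-- true at w imply their own necessitation; so eliminating it keeps the disjunction
-- of the remaining valuations provable. Once nothing more can be eliminated,
-- the remaining valuations are the worlds of a finite m-model in which truth is
-- evaluation: either all of them satisfy φ₀, and then ⊢ φ₀, or φ₀ is refuted.
module Submission where

open import Data.Bool using (Bool; true; false; if_then_else_; not; _∧_; _∨_) renaming (T to True)
open import Data.Bool.Properties using () renaming (_≟_ to _≟ᵇ_)
open import Data.Empty using (⊥)
open import Data.Fin using (Fin)
open import Data.Fin.Properties using (all?)
open import Data.List using (List; []; _∷_; _++_; concatMap; filter; foldr; length; lookup; map)
open import Data.List.Membership.Propositional using (find; lose) renaming (_∈_ to _∈ˡ_)
open import Data.List.Membership.Propositional.Properties
  using (∈-++⁺ˡ; ∈-++⁺ʳ; ∈-++⁻; ∈-concatMap⁺; ∈-concatMap⁻; ∈-filter⁺; ∈-lookup)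
open import Data.List.Properties using (filter-notAll)
open import Data.List.Relation.Binary.Subset.Propositional using () renaming (_⊆_ to _⊆ˡ_)
import Data.List.Relation.Unary.All as All
import Data.List.Relation.Unary.Any as Any
open import Data.List.Relation.Unary.All using (All; []; _∷_)
open import Data.List.Relation.Unary.All.Properties using (++⁺; ¬All⇒Any¬; map⁻; map⁺)
open import Data.List.Relation.Unary.Any using (Any; here; there)
open import Data.List.Relation.Unary.Any.Properties using (lookup-index)
open import Data.Nat using (_<_) renaming (_≡ᵇ_ to _≡ⁿ_)
open import Data.Nat.Induction using (<-wellFounded)
open import Data.Nat.Properties using (≡ᵇ⇒≡; ≡⇒≡ᵇ)
open import Data.Product using (_×_; _,_; proj₁; proj₂; ∃-syntax; Σ-syntax)
open import Data.Sum using (_⊎_; inj₁; inj₂)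
open import Data.Unit using (tt)
open import Function using (_∘_; id)
open import Function.Construct.Identity using (↔-id)
open import Induction.WellFounded using (Acc; acc)
open import Level using (0ℓ)
open import Relation.Binary.PropositionalEquality using (_≡_; refl; sym; trans; cong; cong₂)
open import Relation.Nullary using (¬_; Dec; does; proof; yes; no; contradiction)
open import Relation.Nullary.Decidable using (map′; ¬?; _×-dec_; _⊎-dec_; _→-dec_)
open import Relation.Nullary.Reflects
  using (Reflects; ofʸ; ofⁿ; ¬-reflects; _×-reflects_; _⊎-reflects_; _→-reflects_)
open import Relation.Unary using (Pred; Decidable; _∈_; _⊆_; _≐_; _∩_)
open import Defs

-- Propositional consequence

Valuation : Set
Valuation = Formula → Bool

⊤ᶠ : Formula
⊤ᶠ = ¬ᶠ ⊥ᶠ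

infix 4 _⊩_

_⊩_ : Valuation → Formula → Set
v ⊩ φ = eval v φ ≡ true

⊩→-intro : ∀ {v} φ ψ → (v ⊩ φ → v ⊩ ψ) → v ⊩ φ →ᶠ ψ
⊩→-intro {v} φ ψ h with eval v φ
... | true  = h refl
... | false = refl

⊩→-elim : ∀ {v} φ ψ → v ⊩ φ →ᶠ ψ → v ⊩ φ → v ⊩ ψ
⊩→-elim {v} φ ψ h p rewrite p = h

⊩¬-intro : ∀ {v} φ → ¬ v ⊩ φ → v ⊩ ¬ᶠ φ
⊩¬-intro {v} φ h with eval v φ
... | true  = contradiction refl h
... | false = refl

⊩¬-elim : ∀ {v} φ → v ⊩ ¬ᶠ φ → ¬ v ⊩ φ
⊩¬-elim {v} φ h p rewrite p with h
... | ()

entails : ∀ {φ ψ} → (∀ v → v ⊩ φ → v ⊩ ψ) → ⊢ φ →ᶠ ψ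
entails {φ} {ψ} h = taut λ v → ⊩→-intro φ ψ (h v)

-- Propositional steps are justified valuation by valuation: such an argument makes the
-- corresponding implication an instance of `taut`, so no Hilbert derivation has to be written.
consequence : ∀ {φ ψ χ} → (∀ v → v ⊩ φ → v ⊩ ψ → v ⊩ χ) → ⊢ φ → ⊢ ψ → ⊢ χ
consequence {φ} {ψ} {χ} h p q =
  mp (mp (entails λ v a → ⊩→-intro ψ χ (h v a)) p) q

→-trans : ∀ {φ ψ χ} → ⊢ φ →ᶠ ψ → ⊢ ψ →ᶠ χ → ⊢ φ →ᶠ χ
→-trans {φ} {ψ} {χ} = consequence λ v f g →
  ⊩→-intro φ χ (⊩→-elim ψ χ g ∘ ⊩→-elim φ ψ f)

-- Conjunctions

⋀ : List Formula → Formula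
⋀ = foldr _∧ᶠ_ ⊤ᶠ

⊩∧-intro : ∀ {v} φ ψ → v ⊩ φ → v ⊩ ψ → v ⊩ φ ∧ᶠ ψ
⊩∧-intro φ ψ p q rewrite p = q

⊩∧-elim : ∀ {v} φ ψ → v ⊩ φ ∧ᶠ ψ → v ⊩ φ × v ⊩ ψ
⊩∧-elim {v} φ ψ h with eval v φ | eval v ψ
⊩∧-elim φ ψ refl | true | true = refl , refl

⊩⋀-intro : ∀ {v} Γ → All (v ⊩_) Γ → v ⊩ ⋀ Γ
⊩⋀-intro []      []       = refl
⊩⋀-intro (φ ∷ Γ) (p ∷ ps) = ⊩∧-intro φ (⋀ Γ) p (⊩⋀-intro Γ ps)

⊩⋀-elim : ∀ {v} Γ → v ⊩ ⋀ Γ → All (v ⊩_) Γ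
⊩⋀-elim []      _ = []
⊩⋀-elim (φ ∷ Γ) h = let p , q = ⊩∧-elim φ (⋀ Γ) h in p ∷ ⊩⋀-elim Γ q

→-weaken : ∀ {φ ψ} → ⊢ φ → ⊢ ψ →ᶠ φ
→-weaken {φ} {ψ} = mp (entails λ v p → ⊩→-intro {v} ψ φ λ _ → p)

→-curry : ∀ {φ ψ χ} → ⊢ φ ∧ᶠ ψ →ᶠ χ → ⊢ φ →ᶠ ψ →ᶠ χ
→-curry {φ} {ψ} {χ} = mp (entails λ v h →
  ⊩→-intro φ (ψ →ᶠ χ) λ p → ⊩→-intro ψ χ λ q →
    ⊩→-elim (φ ∧ᶠ ψ) χ h (⊩∧-intro φ ψ p q))

□-mono : ∀ {φ ψ} → ⊢ φ →ᶠ ψ → ⊢ □ φ →ᶠ □ ψ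
□-mono p = mp K (nec p)

□-∧ : ∀ {φ ψ} → ⊢ □ φ →ᶠ □ ψ →ᶠ □ (φ ∧ᶠ ψ)
□-∧ {φ} {ψ} = →-trans
  (□-mono (entails λ v p → ⊩→-intro ψ (φ ∧ᶠ ψ) (⊩∧-intro φ ψ p))) K

-- `□` distributes over conjunction, so implying one's own necessitation passes from conjuncts to a
-- conjunction. The empty list gives the case of `⊤ᶠ`.
⋀-□ : ∀ Γ → All (λ φ → ⊢ φ →ᶠ □ φ) Γ → ⊢ ⋀ Γ →ᶠ □ ⋀ Γ
⋀-□ []      []       = →-weaken (nec (taut λ _ → refl))
⋀-□ (φ ∷ Γ) (p ∷ ps) = consequence
  (λ v f g → ⊩→-intro (φ ∧ᶠ ⋀ Γ) (□ (φ ∧ᶠ ⋀ Γ)) λ h →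
    let a , b = ⊩∧-elim φ (⋀ Γ) h
    in ⊩→-elim {v} (□ ⋀ Γ) (□ (φ ∧ᶠ ⋀ Γ))
         (⊩→-elim φ (□ ⋀ Γ →ᶠ □ (φ ∧ᶠ ⋀ Γ)) f a)
         (⊩→-elim (⋀ Γ) (□ ⋀ Γ) g b))
  (→-trans p □-∧) (⋀-□ Γ ps)

-- Atoms and valuations

infix 4 _==_

_==_ : Formula → Formula → Bool
var p == var q = p ≡ⁿ q
⊥ᶠ == ⊥ᶠ = true
¬ᶠ φ == ¬ᶠ ψ = φ == ψ
φ ∧ᶠ φ′ == ψ ∧ᶠ ψ′ = (φ == ψ) ∧ (φ′ == ψ′)
φ ∨ᶠ φ′ == ψ ∨ᶠ ψ′ = (φ == ψ) ∧ (φ′ == ψ′)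
φ →ᶠ φ′ == ψ →ᶠ ψ′ = (φ == ψ) ∧ (φ′ == ψ′)
□ φ == □ ψ = φ == ψ
𝒪⟨ φ / φ′ ⟩ == 𝒪⟨ ψ / ψ′ ⟩ = (φ == ψ) ∧ (φ′ == ψ′)
_ == _ = false

==-refl : ∀ φ → (φ == φ) ≡ true
==-refl (var p) with p ≡ⁿ p | ≡⇒≡ᵇ p p refl
... | true | _ = refl
==-refl ⊥ᶠ = refl
==-refl (¬ᶠ φ) = ==-refl φ
==-refl (φ ∧ᶠ ψ) = cong₂ _∧_ (==-refl φ) (==-refl ψ)
==-refl (φ ∨ᶠ ψ) = cong₂ _∧_ (==-refl φ) (==-refl ψ)
==-refl (φ →ᶠ ψ) = cong₂ _∧_ (==-refl φ) (==-refl ψ)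
==-refl (□ φ) = ==-refl φ
==-refl 𝒪⟨ φ / ψ ⟩ = cong₂ _∧_ (==-refl φ) (==-refl ψ)

==⇒≡ : ∀ φ ψ → True (φ == ψ) → φ ≡ ψ
==⇒≡₂ : ∀ (_⊕_ : Formula → Formula → Formula) φ φ′ ψ ψ′ →
        True ((φ == ψ) ∧ (φ′ == ψ′)) → φ ⊕ φ′ ≡ ψ ⊕ ψ′

==⇒≡ (var p) (var q) t = cong var (≡ᵇ⇒≡ p q t)
==⇒≡ ⊥ᶠ ⊥ᶠ _ = refl
==⇒≡ (¬ᶠ φ) (¬ᶠ ψ) t = cong ¬ᶠ_ (==⇒≡ φ ψ t)
==⇒≡ (φ ∧ᶠ φ′) (ψ ∧ᶠ ψ′) t = ==⇒≡₂ _∧ᶠ_ φ φ′ ψ ψ′ t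
==⇒≡ (φ ∨ᶠ φ′) (ψ ∨ᶠ ψ′) t = ==⇒≡₂ _∨ᶠ_ φ φ′ ψ ψ′ t
==⇒≡ (φ →ᶠ φ′) (ψ →ᶠ ψ′) t = ==⇒≡₂ _→ᶠ_ φ φ′ ψ ψ′ t
==⇒≡ (□ φ) (□ ψ) t = cong □_ (==⇒≡ φ ψ t)
==⇒≡ 𝒪⟨ φ / φ′ ⟩ 𝒪⟨ ψ / ψ′ ⟩ t = ==⇒≡₂ 𝒪⟨_/_⟩ φ φ′ ψ ψ′ t

==⇒≡₂ _⊕_ φ φ′ ψ ψ′ t with φ == ψ | ==⇒≡ φ ψ
... | true | φ≡ψ = cong₂ _⊕_ (φ≡ψ tt) (==⇒≡ φ′ ψ′ t)

-- Agreement is measured by `eval`, whereas updates change the valuation itself; on these formulae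
-- the two coincide.
Atomic : Formula → Set
Atomic α = ∀ v → eval v α ≡ v α

atoms : Formula → List Formula
atoms (var p)      = var p ∷ []
atoms ⊥ᶠ           = []
atoms (¬ᶠ φ)       = atoms φ
atoms (φ ∧ᶠ ψ)     = atoms φ ++ atoms ψ
atoms (φ ∨ᶠ ψ)     = atoms φ ++ atoms ψ
atoms (φ →ᶠ ψ)     = atoms φ ++ atoms ψ
atoms (□ φ)        = □ φ ∷ atoms φ
atoms 𝒪⟨ φ / ψ ⟩   = 𝒪⟨ φ / ψ ⟩ ∷ atoms φ ++ atoms ψ

atoms-atomic : ∀ φ → All Atomic (atoms φ)
atoms-atomic (var p)    = (λ _ → refl) ∷ []
atoms-atomic ⊥ᶠ         = []
atoms-atomic (¬ᶠ φ)     = atoms-atomic φ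
atoms-atomic (φ ∧ᶠ ψ)   = ++⁺ (atoms-atomic φ) (atoms-atomic ψ)
atoms-atomic (φ ∨ᶠ ψ)   = ++⁺ (atoms-atomic φ) (atoms-atomic ψ)
atoms-atomic (φ →ᶠ ψ)   = ++⁺ (atoms-atomic φ) (atoms-atomic ψ)
atoms-atomic (□ φ)      = (λ _ → refl) ∷ atoms-atomic φ
atoms-atomic 𝒪⟨ φ / ψ ⟩ = (λ _ → refl) ∷ ++⁺ (atoms-atomic φ) (atoms-atomic ψ)

-- Ensures that valuations agreeing on `atoms φ` also agree on the arguments of every modal atom in
-- it.
atoms-closed : ∀ φ {α} → α ∈ˡ atoms φ → atoms α ⊆ˡ atoms φ
atoms-closed₂ : ∀ φ ψ {α} → α ∈ˡ atoms φ ++ atoms ψ → atoms α ⊆ˡ atoms φ ++ atoms ψ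

atoms-closed (var p)    (here refl) = id
atoms-closed (¬ᶠ φ)     α∈          = atoms-closed φ α∈
atoms-closed (φ ∧ᶠ ψ)   α∈          = atoms-closed₂ φ ψ α∈
atoms-closed (φ ∨ᶠ ψ)   α∈          = atoms-closed₂ φ ψ α∈
atoms-closed (φ →ᶠ ψ)   α∈          = atoms-closed₂ φ ψ α∈
atoms-closed (□ φ)      (here refl) = id
atoms-closed (□ φ)      (there α∈)  = there ∘ atoms-closed φ α∈
atoms-closed 𝒪⟨ φ / ψ ⟩ (here refl) = id
atoms-closed 𝒪⟨ φ / ψ ⟩ (there α∈)  = there ∘ atoms-closed₂ φ ψ α∈

atoms-closed₂ φ ψ α∈ with ∈-++⁻ (atoms φ) α∈
... | inj₁ α∈φ = ∈-++⁺ˡ ∘ atoms-closed φ α∈φ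
... | inj₂ α∈ψ = ∈-++⁺ʳ (atoms φ) ∘ atoms-closed ψ α∈ψ

Agree : List Formula → Valuation → Valuation → Set
Agree Γ u v = ∀ {α} → α ∈ˡ Γ → eval u α ≡ eval v α

eval-agree : ∀ {u v} φ → Agree (atoms φ) u v → eval u φ ≡ eval v φ
eval-agree₂ : ∀ {u v} (_⊕_ : Bool → Bool → Bool) φ ψ → Agree (atoms φ ++ atoms ψ) u v →
              eval u φ ⊕ eval u ψ ≡ eval v φ ⊕ eval v ψ

eval-agree (var p)    a = a (here refl)
eval-agree ⊥ᶠ         a = refl
eval-agree (¬ᶠ φ)     a = cong not (eval-agree φ a)
eval-agree (φ ∧ᶠ ψ)   a = eval-agree₂ _∧_ φ ψ a
eval-agree (φ ∨ᶠ ψ)   a = eval-agree₂ _∨_ φ ψ a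
eval-agree (φ →ᶠ ψ)   a = eval-agree₂ (λ b c → not b ∨ c) φ ψ a
eval-agree (□ φ)      a = a (here refl)
eval-agree 𝒪⟨ φ / ψ ⟩ a = a (here refl)

eval-agree₂ _⊕_ φ ψ a =
  cong₂ _⊕_ (eval-agree φ (a ∘ ∈-++⁺ˡ)) (eval-agree ψ (a ∘ ∈-++⁺ʳ (atoms φ)))

-- Diagrams and covering lists

literal : Valuation → Formula → Formula
literal v α = if eval v α then α else ¬ᶠ α

⊩literal-intro : ∀ {u v} α → eval u α ≡ eval v α → u ⊩ literal v α
⊩literal-intro {u} {v} α eq with eval v α
... | true  = eq
... | false = cong not eq

⊩literal-elim : ∀ {u v} α → u ⊩ literal v α → eval u α ≡ eval v α
⊩literal-elim {u} {v} α p with eval v α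
... | true  = p
... | false with eval u α
...   | false = refl

-- The state description of `v` on `Γ`: its models are exactly the valuations agreeing with `v`
-- there.
diagram : List Formula → Valuation → Formula
diagram Γ v = ⋀ (map (literal v) Γ)

⊩diagram-intro : ∀ {u v} Γ → Agree Γ u v → u ⊩ diagram Γ v
⊩diagram-intro Γ a =
  ⊩⋀-intro _ (map⁺ (All.tabulate λ {α} α∈ → ⊩literal-intro α (a α∈)))

⊩diagram-elim : ∀ {u v} Γ → u ⊩ diagram Γ v → Agree Γ u v
⊩diagram-elim Γ p {α} α∈ = ⊩literal-elim α (All.lookup (map⁻ (⊩⋀-elim _ p)) α∈)

_[_≔_] : Valuation → Formula → Bool → Valuation
(v [ α ≔ b ]) β = if α == β then b else v β

valuations : List Formula → List Valuation
valuations []      = (λ _ → false) ∷ []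
valuations (α ∷ Γ) = concatMap (λ v → v [ α ≔ true ] ∷ v [ α ≔ false ] ∷ []) (valuations Γ)

-- The disjunction of the diagrams of S, by its elimination rule.
Covers : List Formula → List Valuation → Set
Covers Γ S = ∀ {ψ} → (∀ {v} → v ∈ˡ S → ⊢ diagram Γ v →ᶠ ψ) → ⊢ ψ

agree-extend : ∀ {u v α b} Γ → All Atomic (α ∷ Γ) →
               Agree Γ u v → eval u α ≡ b → Agree (α ∷ Γ) u (v [ α ≔ b ])
agree-extend {v = v} {α} {b} Γ (at ∷ _) a eq (here refl) = trans eq (sym
  (trans (at (v [ α ≔ b ])) (cong (λ c → if c then b else v α) (==-refl α))))
agree-extend {u} {v} {α} {b} Γ (_ ∷ ats) a eq {β} (there β∈)
  rewrite All.lookup ats β∈ (v [ α ≔ b ])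
  with α == β | ==⇒≡ α β
-- A repeated atom: here `β` is `α`, so the updated value is compared through `eq` and not through
-- the agreement on `Γ`.
... | true  | α≡β = trans (cong (eval u) (sym (α≡β tt))) eq
... | false | _   = trans (a β∈) (All.lookup ats β∈ v)

-- Excluded middle on one atom at a time: the diagram of `v` on `Γ` implies the disjunction of the
-- diagrams of its two updates at `α`.
valuations-cover : ∀ Γ → All Atomic Γ → Covers Γ (valuations Γ)
valuations-cover []      _          h = mp (h (here refl)) (taut λ _ → refl)
valuations-cover (α ∷ Γ) (at ∷ ats) {ψ} h = valuations-cover Γ ats λ {v} v∈ →
  consequence (split v)
    (h (∈-concatMap⁺ _ (lose v∈ (here refl))))
    (h (∈-concatMap⁺ _ (lose v∈ (there (here refl)))))
  where
  δ : Valuation → Bool → Formula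
  δ v b = diagram (α ∷ Γ) (v [ α ≔ b ])

  split : ∀ v u → u ⊩ δ v true →ᶠ ψ → u ⊩ δ v false →ᶠ ψ → u ⊩ diagram Γ v →ᶠ ψ
  split v u f g = ⊩→-intro (diagram Γ v) ψ λ d →
    let extend : ∀ b → eval u α ≡ b → u ⊩ δ v b
        extend b eq = ⊩diagram-intro (α ∷ Γ)
          (agree-extend {v = v} Γ (at ∷ ats) (⊩diagram-elim Γ d) eq)
    in case-eval extend
    where
    case-eval : (∀ b → eval u α ≡ b → u ⊩ δ v b) → u ⊩ ψ
    case-eval extend with eval u α | extend
    ... | true  | e = ⊩→-elim (δ v true) ψ f (e true refl)
    ... | false | e = ⊩→-elim (δ v false) ψ g (e false refl)

-- Soundness for decidable m-models

reflects : ∀ {A : Set} {b} → (b ≡ true → A) → (A → b ≡ true) → Reflects A b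
reflects {b = true}  f _ = ofʸ (f refl)
reflects {b = false} _ g = ofⁿ λ x → contradiction (g x) λ ()

holds : ∀ {A : Set} {b} → Reflects A b → b ≡ true → A
holds (ofʸ x) _ = x

evaluates : ∀ {A : Set} {b} → Reflects A b → A → b ≡ true
evaluates (ofʸ _)  _ = refl
evaluates (ofⁿ ¬x) x = contradiction x ¬x

module _ (M : MModel) where
  open MModel M

  eval-reflects : ∀ {v w} → (∀ φ → Reflects (⟦ φ ⟧ w) (v φ)) →
                  ∀ φ → Reflects (⟦ φ ⟧ w) (eval v φ)
  eval-reflects r (var p)    = r (var p)
  eval-reflects r ⊥ᶠ         = ofⁿ λ ()
  eval-reflects r (¬ᶠ φ)     = ¬-reflects (eval-reflects r φ)
  eval-reflects r (φ ∧ᶠ ψ)   = eval-reflects r φ ×-reflects eval-reflects r ψ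
  eval-reflects r (φ ∨ᶠ ψ)   = eval-reflects r φ ⊎-reflects eval-reflects r ψ
  eval-reflects r (φ →ᶠ ψ)   = eval-reflects r φ →-reflects eval-reflects r ψ
  eval-reflects r (□ φ)      = r (□ φ)
  eval-reflects r 𝒪⟨ φ / ψ ⟩ = r 𝒪⟨ φ / ψ ⟩

  -- Decidable truth turns each world into a Boolean valuation, to which a classical tautology
  -- applies even in this constructive setting.
  soundness : (∀ φ → Decidable ⟦ φ ⟧) → ∀ {φ} → ⊢ φ → M ⊨ φ
  soundness dec {φ} (taut t) w
    with eval (λ ψ → does (dec ψ w)) φ
       | t (λ ψ → does (dec ψ w))
       | eval-reflects {w = w} (λ ψ → proof (dec ψ w)) φ
  ... | _ | refl | ofʸ p = p
  soundness dec K          w = λ f g r → f r (g r)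
  soundness dec T          w = λ f → f R-refl
  soundness dec four       w = λ f r r′ → f (R-trans r r′)
  soundness dec ax₁        w = λ (f , o) → η-upward o (λ (p , r) → f r p , r) proj₂
  -- The boxed premise puts `⟦ ψ ⟧ ∩ R w` inside the relative complement of `⟦ φ ⟧ ∩ R w`; upward
  -- closure lifts `o′` to that complement, which `η-∁` excludes.
  soundness dec ax₂        w = λ f (o , o′) →
    η-∁ o (η-upward o′ (λ (q , r) → (λ (p , _) → f r q p) , r) proj₂)
  soundness dec ax₃        w = λ (f , o) → η-resp-≐ (id , id)
    ((λ (p , r) → proj₁ (f r) p , r) , (λ (p , r) → proj₂ (f r) p , r)) o
  soundness dec (mp p q)   w = soundness dec p w (soundness dec q w)
  soundness dec (nec p)    w = λ _ → soundness dec p _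

-- Elimination

-- Since ⊤ᶠ is never refuted, the pair (⊤ᶠ , ρ) demands ρ itself.
laws : Formula → Formula → List (Formula × Formula)
laws (□ χ)      _          = (χ , □ χ) ∷ (⊤ᶠ , □ χ →ᶠ χ) ∷ []
laws 𝒪⟨ a / b ⟩ 𝒪⟨ c / d ⟩ =
  ((a →ᶠ c) ∧ᶠ (b →ᶠ d) ∧ᶠ (d →ᶠ b) , 𝒪⟨ a / b ⟩ →ᶠ 𝒪⟨ c / d ⟩) ∷
  ((c →ᶠ ¬ᶠ a) ∧ᶠ (d →ᶠ b) ∧ᶠ (b →ᶠ d) , ¬ᶠ (𝒪⟨ a / b ⟩ ∧ᶠ 𝒪⟨ c / d ⟩)) ∷ []
laws _          _          = []

-- The deontic laws merge `ax₃` with `ax₁` or `ax₂`. Both pass through `𝒪⟨ c / b ⟩`, which need not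
-- be an atom of the formula under study, so the merged forms speak of the two given atoms alone.
laws-derivable : ∀ α β {θ ρ} → (θ , ρ) ∈ˡ laws α β → ⊢ □ θ →ᶠ ρ
laws-derivable (□ χ) _ (here refl)         = entails λ _ → id
laws-derivable (□ χ) _ (there (here refl)) = →-weaken T
laws-derivable 𝒪⟨ a / b ⟩ 𝒪⟨ c / d ⟩ (here refl) =
  consequence combine
    (→-trans (□-mono (entails λ _ → proj₁ ∘ ⊩∧-elim a→c b↔d)) (→-curry ax₁))
    (→-trans (□-mono (entails λ _ → proj₂ ∘ ⊩∧-elim a→c b↔d)) (→-curry ax₃))
  where
  a→c = a →ᶠ c
  b↔d = (b →ᶠ d) ∧ᶠ (d →ᶠ b)
  combine : ∀ v → v ⊩ □ (a→c ∧ᶠ b↔d) →ᶠ 𝒪⟨ a / b ⟩ →ᶠ 𝒪⟨ c / b ⟩ →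
            v ⊩ □ (a→c ∧ᶠ b↔d) →ᶠ 𝒪⟨ c / b ⟩ →ᶠ 𝒪⟨ c / d ⟩ →
            v ⊩ □ (a→c ∧ᶠ b↔d) →ᶠ 𝒪⟨ a / b ⟩ →ᶠ 𝒪⟨ c / d ⟩
  combine v p q with v (□ (a→c ∧ᶠ b↔d)) | v 𝒪⟨ a / b ⟩ | v 𝒪⟨ c / b ⟩
  ... | false | _     | _    = refl
  ... | true  | false | _    = refl
  ... | true  | true  | true = q
laws-derivable 𝒪⟨ a / b ⟩ 𝒪⟨ c / d ⟩ (there (here refl)) =
  consequence combine
    (→-trans (□-mono (entails λ _ → proj₁ ∘ ⊩∧-elim c→¬a d↔b)) ax₂)
    (→-trans (□-mono (entails λ _ → proj₂ ∘ ⊩∧-elim c→¬a d↔b)) (→-curry ax₃))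
  where
  c→¬a = c →ᶠ ¬ᶠ a
  d↔b = (d →ᶠ b) ∧ᶠ (b →ᶠ d)
  combine : ∀ v → v ⊩ □ (c→¬a ∧ᶠ d↔b) →ᶠ ¬ᶠ (𝒪⟨ a / b ⟩ ∧ᶠ 𝒪⟨ c / b ⟩) →
            v ⊩ □ (c→¬a ∧ᶠ d↔b) →ᶠ 𝒪⟨ c / d ⟩ →ᶠ 𝒪⟨ c / b ⟩ →
            v ⊩ □ (c→¬a ∧ᶠ d↔b) →ᶠ ¬ᶠ (𝒪⟨ a / b ⟩ ∧ᶠ 𝒪⟨ c / d ⟩)
  combine v p q
    with v (□ (c→¬a ∧ᶠ d↔b)) | v 𝒪⟨ a / b ⟩ | v 𝒪⟨ c / b ⟩ | v 𝒪⟨ c / d ⟩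
  ... | false | _     | _     | _     = refl
  ... | true  | false | _     | _     = refl
  ... | true  | true  | _     | false = refl
  ... | true  | true  | false | true  = q

known : Valuation → Formula → Formula
known w (□ χ) = if w (□ χ) then □ χ else ⊤ᶠ
known w _     = ⊤ᶠ

-- A boxed atom true at `w` is handled by `four`; everything else contributes the neutral `⊤ᶠ`,
-- which is `⋀ []`.
known-□ : ∀ w α → ⊢ known w α →ᶠ □ known w α
known-□ w (□ χ) with w (□ χ)
... | true  = four
... | false = ⋀-□ [] []
known-□ w (var _)    = ⋀-□ [] []
known-□ w ⊥ᶠ         = ⋀-□ [] []
known-□ w (¬ᶠ _)     = ⋀-□ [] []
known-□ w (_ ∧ᶠ _)   = ⋀-□ [] []
known-□ w (_ ∨ᶠ _)   = ⋀-□ [] []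
known-□ w (_ →ᶠ _)   = ⋀-□ [] []
known-□ w 𝒪⟨ _ / _ ⟩ = ⋀-□ [] []

⊩known-intro : ∀ {v} w α →
               (∀ {χ} → α ≡ □ χ → w ⊩ □ χ → v ⊩ □ χ) → v ⊩ known w α
⊩known-intro w (□ χ) h with w (□ χ) | h refl
... | true  | p = p refl
... | false | _ = refl
⊩known-intro w (var _)    _ = refl
⊩known-intro w ⊥ᶠ         _ = refl
⊩known-intro w (¬ᶠ _)     _ = refl
⊩known-intro w (_ ∧ᶠ _)   _ = refl
⊩known-intro w (_ ∨ᶠ _)   _ = refl
⊩known-intro w (_ →ᶠ _)   _ = refl
⊩known-intro w 𝒪⟨ _ / _ ⟩ _ = refl

⊩known-elim : ∀ {v} w χ → v ⊩ known w (□ χ) → w ⊩ □ χ → v ⊩ □ χ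
⊩known-elim w χ p q rewrite q = p

module _ (φ₀ : Formula) where

  At : List Formula
  At = atoms φ₀

  -- A diagram pins a valuation down only on `At`; these are the formulae whose truth value it
  -- thereby decides.
  Local : Formula → Set
  Local φ = ∀ {u v} → Agree At u v → eval u φ ≡ eval v φ

  ⊆⇒local : ∀ φ → atoms φ ⊆ˡ At → Local φ
  ⊆⇒local φ i a = eval-agree φ (a ∘ i)

  ∈⇒local : ∀ {α} → α ∈ˡ At → Local α
  ∈⇒local α∈ a = a α∈

  □∈⇒local : ∀ {χ} → □ χ ∈ˡ At → Local χ
  □∈⇒local {χ} α∈ = ⊆⇒local χ (atoms-closed φ₀ α∈ ∘ there)

  𝒪∈⇒local : ∀ {a b} → 𝒪⟨ a / b ⟩ ∈ˡ At → Local a × Local b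
  𝒪∈⇒local {a} {b} α∈ =
    ⊆⇒local a (atoms-closed φ₀ α∈ ∘ there ∘ ∈-++⁺ˡ) ,
    ⊆⇒local b (atoms-closed φ₀ α∈ ∘ there ∘ ∈-++⁺ʳ (atoms a))

  laws-local : ∀ α β {θ ρ} → α ∈ˡ At → β ∈ˡ At → (θ , ρ) ∈ˡ laws α β → Local θ × Local ρ
  laws-local (□ χ) _ α∈ _ (here refl) = □∈⇒local α∈ , ∈⇒local α∈
  laws-local (□ χ) _ α∈ _ (there (here refl)) =
    (λ _ → refl) , λ g → cong₂ (λ x y → not x ∨ y) (g α∈) (□∈⇒local α∈ g)
  laws-local 𝒪⟨ a / b ⟩ 𝒪⟨ c / d ⟩ α∈ β∈ (here refl) = θ-local , ρ-local
    where
    θ-local : Local ((a →ᶠ c) ∧ᶠ (b →ᶠ d) ∧ᶠ (d →ᶠ b))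
    θ-local g rewrite proj₁ (𝒪∈⇒local α∈) g | proj₂ (𝒪∈⇒local α∈) g
                    | proj₁ (𝒪∈⇒local β∈) g | proj₂ (𝒪∈⇒local β∈) g = refl
    ρ-local : Local (𝒪⟨ a / b ⟩ →ᶠ 𝒪⟨ c / d ⟩)
    ρ-local g rewrite g α∈ | g β∈ = refl
  laws-local 𝒪⟨ a / b ⟩ 𝒪⟨ c / d ⟩ α∈ β∈ (there (here refl)) = θ-local , ρ-local
    where
    θ-local : Local ((c →ᶠ ¬ᶠ a) ∧ᶠ (d →ᶠ b) ∧ᶠ (b →ᶠ d))
    θ-local g rewrite proj₁ (𝒪∈⇒local α∈) g | proj₂ (𝒪∈⇒local α∈) g
                    | proj₁ (𝒪∈⇒local β∈) g | proj₂ (𝒪∈⇒local β∈) g = refl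
    ρ-local : Local (¬ᶠ (𝒪⟨ a / b ⟩ ∧ᶠ 𝒪⟨ c / d ⟩))
    ρ-local g rewrite g α∈ | g β∈ = refl

  obligations : List (Formula × Formula)
  obligations = concatMap (λ α → concatMap (laws α) At) At

  laws⊆obligations : ∀ {α β} → α ∈ˡ At → β ∈ˡ At → laws α β ⊆ˡ obligations
  laws⊆obligations α∈ β∈ l∈ =
    ∈-concatMap⁺ _ (lose α∈ (∈-concatMap⁺ _ (lose β∈ l∈)))

  obligations⊆laws : ∀ {l} → l ∈ˡ obligations →
                     ∃[ α ] ∃[ β ] α ∈ˡ At × β ∈ˡ At × l ∈ˡ laws α β
  obligations⊆laws l∈ =
    let α , α∈ , l∈α = find (∈-concatMap⁻ _ {xs = At} l∈)
        β , β∈ , l∈β = find (∈-concatMap⁻ (laws α) {xs = At} l∈α)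
    in α , β , α∈ , β∈ , l∈β

  -- Accessibility between valuations

  knowledge : Valuation → Formula
  knowledge w = ⋀ (map (known w) At)

  infix 4 _▷_

  -- Coding accessibility as satisfaction of a single formula makes it decidable and lets
  -- derivations speak about all successors of `w` at once.
  _▷_ : Valuation → Valuation → Set
  w ▷ v = v ⊩ knowledge w

  ▷-intro : ∀ {w v} → (∀ {χ} → □ χ ∈ˡ At → w ⊩ □ χ → v ⊩ □ χ) → w ▷ v
  ▷-intro {w} h = ⊩⋀-intro _ (map⁺ (All.tabulate λ {α} α∈ →
    ⊩known-intro w α λ { refl → h α∈ }))

  ▷-elim : ∀ {w v χ} → w ▷ v → □ χ ∈ˡ At → w ⊩ □ χ → v ⊩ □ χ
  ▷-elim {w} {χ = χ} s α∈ = ⊩known-elim w χ (All.lookup (map⁻ (⊩⋀-elim _ s)) α∈)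

  ▷-refl : ∀ {w} → w ▷ w
  ▷-refl = ▷-intro λ _ → id

  ▷-trans : ∀ {u v w} → u ▷ v → v ▷ w → u ▷ w
  ▷-trans {u} {v} s t = ▷-intro λ α∈ → ▷-elim {v} t α∈ ∘ ▷-elim {u} s α∈

  ▷-local : ∀ {w u v} → Agree At u v → w ▷ v → w ▷ u
  ▷-local {w} g s = ▷-intro λ α∈ p → trans (g α∈) (▷-elim {w} s α∈ p)

  knowledge-□ : ∀ w → ⊢ knowledge w →ᶠ □ knowledge w
  knowledge-□ w = ⋀-□ _ (map⁺ (All.universal (known-□ w) At))

  diagram-⊢ : ∀ {v} ψ → (∀ u → Agree At u v → u ⊩ ψ) → ⊢ diagram At v →ᶠ ψ
  diagram-⊢ ψ h = entails λ u d → h u (⊩diagram-elim At d)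

  -- This is `□ θ →ᶠ ρ` at `w`, with `□` ranging over the successors in `S`. The disjunctive form is
  -- decidable and supplies the refuting successor.
  Meets : List Valuation → Valuation → Formula × Formula → Set
  Meets S w (θ , ρ) = w ⊩ ρ ⊎ Any (λ v → w ▷ v × ¬ v ⊩ θ) S

  meets? : ∀ S w → Decidable (Meets S w)
  meets? S w (θ , ρ) = (eval w ρ ≟ᵇ true) ⊎-dec
    Any.any? (λ v → (eval v (knowledge w) ≟ᵇ true) ×-dec ¬? (eval v θ ≟ᵇ true)) S

  Good : List Valuation → Valuation → Set
  Good S w = All (Meets S w) obligations

  good? : ∀ S → Decidable (Good S)
  good? S w = All.all? (meets? S w) obligations

  -- For an unmet `(θ , ρ)`, all successors of `w` in `S` satisfy `θ`, so covering yields
  -- `knowledge w →ᶠ θ`. Boxing this and using `knowledge-□` gives `□ θ`, hence `ρ`; but the diagram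
  -- of `w` implies `knowledge w` and excludes `ρ`.
  bad⇒refutable : ∀ {S w} → Covers At S → ¬ Good S w → ⊢ ¬ᶠ diagram At w
  bad⇒refutable {S} {w} cov bad
    with find (¬All⇒Any¬ (meets? S w) obligations bad)
  ... | (θ , ρ) , l∈ , ¬meets with obligations⊆laws l∈
  ... | α , β , α∈ , β∈ , l∈β = consequence refute d⊢□θ→ρ d⊢knowledge
    where
    θ-local = proj₁ (laws-local α β α∈ β∈ l∈β)
    ρ-local = proj₂ (laws-local α β α∈ β∈ l∈β)

    knows-θ : ⊢ knowledge w →ᶠ θ
    knows-θ = cov λ {v} v∈ → diagram-⊢ (knowledge w →ᶠ θ) λ u g →
      ⊩→-intro (knowledge w) θ λ s → trans (θ-local g) (θ-true v∈ (▷-local (sym ∘ g) s))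
      where
      θ-true : ∀ {v} → v ∈ˡ S → w ▷ v → v ⊩ θ
      θ-true {v} v∈ s with eval v θ ≟ᵇ true
      ... | yes p = p
      ... | no ¬p = contradiction (inj₂ (lose v∈ (s , ¬p))) ¬meets

    d⊢□θ→ρ : ⊢ knowledge w →ᶠ ρ
    d⊢□θ→ρ = →-trans (→-trans (knowledge-□ w) (□-mono knows-θ))
                     (laws-derivable α β l∈β)

    d⊢knowledge : ⊢ diagram At w →ᶠ knowledge w
    d⊢knowledge = diagram-⊢ (knowledge w) λ u g → ▷-local {w} g ▷-refl

    refute : ∀ u → u ⊩ knowledge w →ᶠ ρ → u ⊩ diagram At w →ᶠ knowledge w →
             u ⊩ ¬ᶠ diagram At w
    refute u p q with eval u (diagram At w) in d
    ... | false = refl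
    -- Here `u` agrees with `w` on `At`, so by locality `ρ` would hold at `w` and the obligation
    -- would be met.
    ... | true  = contradiction
      (inj₁ (trans (sym (ρ-local (⊩diagram-elim At d)))
                   (⊩→-elim (knowledge w) ρ p q)))
      ¬meets

  -- Each dropped diagram is refutable and so implies any `ψ`. All bad valuations can go in one
  -- round, since each is refuted relative to the old list `S`.
  filter-covers : ∀ {S} → Covers At S → Covers At (filter (good? S) S)
  filter-covers {S} cov {ψ} h = cov implies
    where
    implies : ∀ {v} → v ∈ˡ S → ⊢ diagram At v →ᶠ ψ
    implies {v} v∈ with good? S v
    ... | yes good = h (∈-filter⁺ (good? S) v∈ good)
    ... | no bad   = mp (entails λ u → absurd u) (bad⇒refutable cov bad)
      where
      absurd : ∀ u → u ⊩ ¬ᶠ diagram At v → u ⊩ diagram At v →ᶠ ψ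
      absurd u p with eval u (diagram At v)
      ... | false = refl

  saturate : ∀ S → Acc _<_ (length S) → Covers At S →
             ∃[ S′ ] Covers At S′ × All (Good S′) S′
  saturate S (acc rec) cov with All.all? (good? S) S
  ... | yes stable = S , cov , stable
  ... | no ¬stable = saturate (filter (good? S) S)
    (rec (filter-notAll (good? S) S (¬All⇒Any¬ (good? S) S ¬stable)))
    (filter-covers cov)

  -- The m-model of a stable list of valuations

  module Canonical (S : List Valuation) (stable : All (Good S) S) (inhabited : Fin (length S)) where

    World : Set
    World = Fin (length S)

    val : World → Valuation
    val = lookup S

    R : World → Pred World 0ℓ
    R i j = val i ▷ val j

    R? : ∀ i → Decidable (R i)
    R? i j = eval (val j) (knowledge (val i)) ≟ᵇ true

    Ext : Formula → Pred World 0ℓ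
    Ext φ i = val i ⊩ φ

    ext? : ∀ φ → Decidable (Ext φ)
    ext? φ i = eval (val i) φ ≟ᵇ true

    -- Stability as the model uses it: a refuting successor would contradict `R i ⊆ Ext θ`, which
    -- leaves only `ρ`.
    law : ∀ {α β} i {θ ρ} → α ∈ˡ At → β ∈ˡ At → (θ , ρ) ∈ˡ laws α β →
          R i ⊆ Ext θ → val i ⊩ ρ
    law i {θ} α∈ β∈ l∈
      with All.lookup (All.lookup stable (∈-lookup i)) (laws⊆obligations α∈ β∈ l∈)
    ... | inj₁ p = λ _ → p
    ... | inj₂ q = λ h → let s , ¬θ = lookup-index q in contradiction (h s) ¬θ

    -- The norm may be weakened to a larger `X`, as in `ax₁`, while the condition `Y` must match up
    -- to equivalence, as in `ax₃`. Taking an arbitrary formula as last argument lets the generating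
    -- atom be sought in `At` by `Any`.
    Grounds : World → Pred World 0ℓ → Pred World 0ℓ → Formula → Set
    Grounds i X Y 𝒪⟨ a / b ⟩ =
      val i ⊩ 𝒪⟨ a / b ⟩ × (R i ∩ Ext a ⊆ X) × (Y ≐ R i ∩ Ext b)
    Grounds i X Y _          = ⊥

    -- The least upward closed neighbourhoods that make the 𝒪-atoms true at i hold there.
    η : World → Pred World 0ℓ → Pred World 0ℓ → Set
    η i X Y = X ⊆ R i × Y ⊆ R i × Any (Grounds i X Y) At

    grounds : ∀ {i X Y} → η i X Y →
              ∃[ a ] ∃[ b ] 𝒪⟨ a / b ⟩ ∈ˡ At × Grounds i X Y 𝒪⟨ a / b ⟩
    grounds (_ , _ , g) with find g
    ... | 𝒪⟨ a / b ⟩ , α∈ , p = a , b , α∈ , p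

    ⊆? : ∀ {X Y : Pred World 0ℓ} → Decidable X → Decidable Y → Dec (X ⊆ Y)
    ⊆? X? Y? = map′ (λ h {j} → h j) (λ h j → h) (all? λ j → X? j →-dec Y? j)

    grounds? : ∀ i {X Y} → Decidable X → Decidable Y → Decidable (Grounds i X Y)
    grounds? i X? Y? 𝒪⟨ a / b ⟩ =
      (eval (val i) 𝒪⟨ a / b ⟩ ≟ᵇ true) ×-dec ⊆? (in? a) X? ×-dec
      ⊆? Y? (in? b) ×-dec ⊆? (in? b) Y?
      where
      in? : ∀ φ → Decidable (R i ∩ Ext φ)
      in? φ j = R? i j ×-dec ext? φ j
    grounds? i X? Y? (var _)  = no λ ()
    grounds? i X? Y? ⊥ᶠ       = no λ ()
    grounds? i X? Y? (¬ᶠ _)   = no λ ()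
    grounds? i X? Y? (_ ∧ᶠ _) = no λ ()
    grounds? i X? Y? (_ ∨ᶠ _) = no λ ()
    grounds? i X? Y? (_ →ᶠ _) = no λ ()
    grounds? i X? Y? (□ _)    = no λ ()

    η? : ∀ i {X Y} → Decidable X → Decidable Y → Dec (η i X Y)
    η? i X? Y? = ⊆? X? (R? i) ×-dec ⊆? Y? (R? i) ×-dec Any.any? (grounds? i X? Y?) At

    η-mono : ∀ {i X X′ Y Y′} → X ⊆ X′ → X′ ⊆ R i → Y ≐ Y′ → η i X Y → η i X′ Y′
    η-mono {i} {X} {X′} {Y} {Y′} X⊆X′ X′⊆R (Y⊆Y′ , Y′⊆Y) (_ , Y⊆R , g) =
      X′⊆R , Y⊆R ∘ Y′⊆Y , Any.map (λ {α} → mono α) g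
      where
      mono : ∀ α → Grounds i X Y α → Grounds i X′ Y′ α
      mono 𝒪⟨ a / b ⟩ (p , a⊆X , Y⊆b , b⊆Y) =
        p , X⊆X′ ∘ a⊆X , Y⊆b ∘ Y′⊆Y , Y⊆Y′ ∘ b⊆Y

    -- Disjoint `X` and `X′` over the same `Y` make the premise of the `ax₂` law true for the two
    -- generating atoms, which then cannot both hold at `i`. Both `η-∅` and `η-∁` are instances, the
    -- former because `∅` is disjoint from itself.
    η-disjoint : ∀ {i X X′ Y} → η i X Y → η i X′ Y → ¬ (∀ {j} → X j → ¬ X′ j)
    η-disjoint {i} {X} {X′} {Y} e e′ disjoint =
      let a , b , α∈ , p , a⊆X , Y⊆b , b⊆Y = grounds e
          c , d , β∈ , q , c⊆X′ , Y⊆d , d⊆Y = grounds e′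
          θ-holds : R i ⊆ Ext ((c →ᶠ ¬ᶠ a) ∧ᶠ (d →ᶠ b) ∧ᶠ (b →ᶠ d))
          θ-holds {j} s =
            ⊩∧-intro (c →ᶠ ¬ᶠ a) ((d →ᶠ b) ∧ᶠ (b →ᶠ d))
              (⊩→-intro c (¬ᶠ a) λ pc → ⊩¬-intro a λ pa →
                disjoint (a⊆X (s , pa)) (c⊆X′ (s , pc)))
              (⊩∧-intro (d →ᶠ b) (b →ᶠ d)
                (⊩→-intro d b λ pd → proj₂ (Y⊆b (d⊆Y (s , pd))))
                (⊩→-intro b d λ pb → proj₂ (Y⊆d (b⊆Y (s , pb)))))
      in ⊩¬-elim {val i} (𝒪⟨ a / b ⟩ ∧ᶠ 𝒪⟨ c / d ⟩)
           (law i α∈ β∈ (there (here refl)) θ-holds)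
           (⊩∧-intro {val i} 𝒪⟨ a / b ⟩ 𝒪⟨ c / d ⟩ p q)

    model : MModel
    model = record
      { frame = record
        { W         = World
        ; inhabited = inhabited
        ; R         = R
        ; η         = η
        ; η-resp-≐  = λ X≐X′ Y≐Y′ e → η-mono (proj₁ X≐X′) (proj₁ e ∘ proj₂ X≐X′) Y≐Y′ e
        ; R-refl    = ▷-refl
        ; R-trans   = λ {i} {j} → ▷-trans {val i} {val j}
        ; η-⊆ˡ      = proj₁
        ; η-⊆ʳ      = proj₁ ∘ proj₂
        ; η-upward  = λ e X⊆Y Y⊆R → η-mono X⊆Y Y⊆R (id , id) e
        ; η-∅       = λ e → η-disjoint e e λ ()
        ; η-∁       = λ e e′ → η-disjoint e e′ λ x (¬x , _) → ¬x x
        }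
      ; σ = λ i p → val i ⊩ var p
      }

    open MModel model using (⟦_⟧)

    -- Derivations may involve formulae whose atoms lie outside `At`, beyond the reach of `truth`;
    -- soundness therefore relies on searching the finite set of worlds.
    decide : ∀ φ → Decidable ⟦ φ ⟧
    decide (var p)    i = ext? (var p) i
    decide ⊥ᶠ         i = no λ ()
    decide (¬ᶠ φ)     i = ¬? (decide φ i)
    decide (φ ∧ᶠ ψ)   i = decide φ i ×-dec decide ψ i
    decide (φ ∨ᶠ ψ)   i = decide φ i ⊎-dec decide ψ i
    decide (φ →ᶠ ψ)   i = decide φ i →-dec decide ψ i
    decide (□ φ)      i = ⊆? (R? i) (decide φ)
    decide 𝒪⟨ φ / ψ ⟩ i = η? i (λ j → decide φ j ×-dec R? i j) (λ j → decide ψ j ×-dec R? i j)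

    truth : ∀ φ → atoms φ ⊆ˡ At → ∀ i → Reflects (⟦ φ ⟧ i) (eval (val i) φ)
    truth (var p)    sub i = reflects id id
    truth ⊥ᶠ         sub i = ofⁿ λ ()
    truth (¬ᶠ φ)     sub i = ¬-reflects (truth φ sub i)
    truth (φ ∧ᶠ ψ)   sub i = truth φ (sub ∘ ∈-++⁺ˡ) i ×-reflects truth ψ (sub ∘ ∈-++⁺ʳ (atoms φ)) i
    truth (φ ∨ᶠ ψ)   sub i = truth φ (sub ∘ ∈-++⁺ˡ) i ⊎-reflects truth ψ (sub ∘ ∈-++⁺ʳ (atoms φ)) i
    truth (φ →ᶠ ψ)   sub i = truth φ (sub ∘ ∈-++⁺ˡ) i →-reflects truth ψ (sub ∘ ∈-++⁺ʳ (atoms φ)) i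
    truth (□ φ)      sub i = reflects
      -- `□ φ` persists along `R`, and the `T` law at `j` then yields `φ`; the demand `⊤ᶠ` of that
      -- law is met trivially.
      (λ p {j} s → holds (truth φ (sub ∘ there) j)
        (⊩→-elim (□ φ) φ (law j □φ∈ □φ∈ (there (here refl)) (λ _ → refl))
          (▷-elim {val i} s □φ∈ p)))
      (λ h → law i □φ∈ □φ∈ (here refl) λ {j} s → evaluates (truth φ (sub ∘ there) j) (h s))
      where
      □φ∈ = sub (here refl)
    truth 𝒪⟨ φ / ψ ⟩ sub i = reflects
      -- A true `𝒪`-atom generates its own neighbourhood.
      (λ p → proj₂ , proj₂ , lose 𝒪∈ (p ,
        (λ {j} (s , pφ) → holds (φ-truth j) pφ , s) ,
        (λ {j} (pψ , s) → s , evaluates (ψ-truth j) pψ) ,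
        (λ {j} (s , pψ) → holds (ψ-truth j) pψ , s)))
      λ e →
        -- The generating atom may differ from `𝒪⟨ φ / ψ ⟩`. By induction its grounds are inclusions
        -- between valuations' extensions, so the first deontic law transfers its truth.
        let a , b , α∈ , p , a⊆φ , ψ⊆b , b⊆ψ = grounds e
            θ-holds : R i ⊆ Ext ((a →ᶠ φ) ∧ᶠ (b →ᶠ ψ) ∧ᶠ (ψ →ᶠ b))
            θ-holds {j} s =
              ⊩∧-intro (a →ᶠ φ) ((b →ᶠ ψ) ∧ᶠ (ψ →ᶠ b))
                (⊩→-intro a φ λ pa → evaluates (φ-truth j) (proj₁ (a⊆φ (s , pa))))
                (⊩∧-intro (b →ᶠ ψ) (ψ →ᶠ b)
                  (⊩→-intro b ψ λ pb → evaluates (ψ-truth j) (proj₁ (b⊆ψ (s , pb))))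
                  (⊩→-intro ψ b λ pψ → proj₂ (ψ⊆b (holds (ψ-truth j) pψ , s))))
        in ⊩→-elim {val i} 𝒪⟨ a / b ⟩ 𝒪⟨ φ / ψ ⟩ (law i α∈ 𝒪∈ (here refl) θ-holds) p
      where
      𝒪∈ = sub (here refl)
      φ-truth = truth φ (sub ∘ there ∘ ∈-++⁺ˡ)
      ψ-truth = truth ψ (sub ∘ there ∘ ∈-++⁺ʳ (atoms φ))

-- Finite model property and decidability

Countermodel : Formula → Set₁
Countermodel φ = Σ[ M ∈ MModel ]
  Finite (MModel.W M) × ¬ (M ⊨ φ) × (∀ ψ → Decidable (MModel.⟦_⟧ M ψ))

-- A constructive dichotomy yields both claims: the finite model property reads off the
-- countermodel, and decidability uses soundness on it, for which decidable truth is carried along.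
provable-or-refuted : ∀ φ → ⊢ φ ⊎ Countermodel φ
provable-or-refuted φ
  with saturate φ (valuations (atoms φ)) (<-wellFounded _)
         (valuations-cover (atoms φ) (atoms-atomic φ))
... | S , cov , stable with All.all? (λ v → eval v φ ≟ᵇ true) S
...   | yes all = inj₁ (cov λ v∈ →
  diagram-⊢ φ φ λ u g → trans (eval-agree φ g) (All.lookup all v∈))
...   | no ¬all = inj₂ (model , (length S , ↔-id _) ,
  (λ valid → lookup-index refuted (evaluates (truth φ id (Any.index refuted)) (valid _))) ,
  decide)
  where
  refuted : Any (λ v → ¬ v ⊩ φ) S
  refuted = ¬All⇒Any¬ (λ v → eval v φ ≟ᵇ true) S ¬all
  -- The refuting valuation also serves as the world showing that the model is non-empty.
  open Canonical φ S stable (Any.index refuted)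

corollary3 : (∀ φ → ¬ (⊢ φ) → Σ[ M ∈ MModel ] (Finite (MModel.W M) × ¬ (M ⊨ φ)))
    × Decidable ⊢_
corollary3 = finite-model-property , decidable
  where
  finite-model-property : ∀ φ → ¬ (⊢ φ) → Σ[ M ∈ MModel ] (Finite (MModel.W M) × ¬ (M ⊨ φ))
  finite-model-property φ ⊬φ with provable-or-refuted φ
  ... | inj₁ ⊢φ                     = contradiction ⊢φ ⊬φ
  ... | inj₂ (M , fin , refuted , _) = M , fin , refuted

  decidable : Decidable ⊢_
  decidable φ with provable-or-refuted φ
  ... | inj₁ ⊢φ                     = yes ⊢φ
  ... | inj₂ (M , _ , refuted , dec) = no λ ⊢φ → refuted (soundness M dec ⊢φ)
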